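{- Let $\Sigma$ be a (possibly infinite) unranked signature, $\mathcal{X}$ an infinite set of variables disjoint from $\Sigma$, and $>$ a well-founded partial order on $\Sigma$. Let $\rightsquigarrow$ be the rewrite relation induced by the term rewrite system $\mathit{Star}$ on the trees $\mathbb{T}(\Sigma\cup\Sigma^\star,\mathcal{X})$. Then the restriction of the transitive closure $\rightsquigarrow^+$ to the star-free trees, i.e. the relation ${\rightsquigarrow^+}\cap(\mathbb{T}(\Sigma,\mathcal{X})\times\mathbb{T}(\Sigma,\mathcal{X}))$, is terminating (strongly normalizing): there is no infinite sequence $t_0,t_1,t_2,\ldots$ in $\mathbb{T}(\Sigma,\mathcal{X})$ with $t_i\rightsquigarrow^+ t_{i+1}$ for all $i$.
   Context: Terms: for an unranked signature $\Gamma$ (a set of symbols without fixed arity) and a set $\mathcal{X}$ of variables disjoint from $\Gamma$, the set of terms $\mathcal{T}(\Gamma,\mathcal{X})$ is the smallest set containing $\mathcal{X}$ and containing $f(t_1,\ldots,t_n)$ for all $f\in\Gamma$, $n\ge 0$ and terms $t_1,\ldots,t_n$. A term rewrite system is a set of rules $\ell\to r$; it induces on terms the rewrite relation $C[\sigma(\ell)]\to C[\sigma(r)]$ for all one-hole contexts $C$, rules $\ell\to r$ and substitutions $\sigma$. Trees: $\simeq$ is the equivalence relation on terms generated by swapping two adjacent arguments of a symbol anywhere inside a term, i.e. generated by the rewrite rules $f(\vec u,x,y,\vec w)\to f(\vec u,y,x,\vec w)$ for all symbols $f$. The set of (unordered) trees is $\mathbb{T}(\Gamma,\mathcal{X})=\mathcal{T}(\Gamma,\mathcal{X})/_{\simeq}$.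 A rewrite relation $\to$ on terms is extended to trees by: $[s]\to[t]$ whenever $s\to t$, for terms $s,t$ with classes $[s],[t]$. Starred signature: $\Sigma^\star=\{f^\star\mid f\in\Sigma\}$, a set of fresh symbols (disjoint from $\Sigma$). The system $\mathit{Star}$ over $\Sigma\cup\Sigma^\star$ consists of the following rules, for all $f,g\in\Sigma$, where $\vec x,\vec y,\vec z$ are finite (possibly empty) vectors of distinct variables: (put) $f(\vec x)\rightsquigarrow f^\star(\vec x)$; (select) $f^\star(\vec x,y,\vec z)\rightsquigarrow y$; (copy) $f^\star(\vec x)\rightsquigarrow g(f^\star(\vec x),\ldots,f^\star(\vec x))$ with $0$ or more copies of $f^\star(\vec x)$, if $f>g$; (down) $f^\star(\vec x,g(\vec y),\vec z)\rightsquigarrow f(\vec x,g^\star(\vec y),\ldots,g^\star(\vec y),\vec z)$ with $0$ or more copies of $g^\star(\vec y)$. -}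

module Defs where

open import Data.Fin.Base using (Fin)
open import Data.List.Base using (List; []; _∷_; _++_; map; replicate)
open import Data.List.Relation.Unary.Unique.Propositional using (Unique)
open import Data.Nat.Base using (ℕ)
open import Data.Product.Base using (∃₂; _×_)
open import Data.Sum.Base using (_⊎_; inj₁; inj₂)
open import Function.Bundles using (_↔_)
open import Level using (Level; _⊔_)
open import Relation.Binary.Bundles using (Setoid)
open import Relation.Binary.Core using (Rel)
import Relation.Binary.Construct.Closure.Equivalence as EqClosure
open import Relation.Binary.Construct.Closure.Transitive using (TransClosure)
open import Relation.Nullary.Negation.Core using (¬_)

private
  variable
    a b ℓ : Level
    Γ Δ Σ : Set a
    X Y : Set b

Infinite : Set b → Set b
Infinite X = ∀ n → ¬ (X ↔ Fin n)

infix 7 _⟨_⟩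

data Term (Γ : Set a) (X : Set b) : Set (a ⊔ b) where
  var   : X → Term Γ X
  _⟨_⟩ : Γ → List (Term Γ X) → Term Γ X

vars : List X → List (Term Γ X)
vars = map var

-- The auxiliary functions on lists below are `map` unfolded, for the sake of
-- the termination checker.
mutual
  subst : (X → Term Γ Y) → Term Γ X → Term Γ Y
  subst σ (var x)    = σ x
  subst σ (f ⟨ ts ⟩) = f ⟨ substs σ ts ⟩

  substs : (X → Term Γ Y) → List (Term Γ X) → List (Term Γ Y)
  substs σ []       = []
  substs σ (t ∷ ts) = subst σ t ∷ substs σ ts

mutual
  relabel : (Γ → Δ) → Term Γ X → Term Δ X
  relabel h (var x)    = var x
  relabel h (f ⟨ ts ⟩) = h f ⟨ relabels h ts ⟩

  relabels : (Γ → Δ) → List (Term Γ X) → List (Term Δ X)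
  relabels h []       = []
  relabels h (t ∷ ts) = relabel h t ∷ relabels h ts

data Context (Γ : Set a) (X : Set b) : Set (a ⊔ b) where
  □       : Context Γ X
  _⟨_,_,_⟩ : Γ → List (Term Γ X) → Context Γ X → List (Term Γ X) → Context Γ X

_[_] : Context Γ X → Term Γ X → Term Γ X
□                   [ t ] = t
(f ⟨ us , C , vs ⟩) [ t ] = f ⟨ us ++ C [ t ] ∷ vs ⟩

TRS : Set a → Set b → (ℓ : Level) → Set _
TRS Γ X ℓ = Rel (Term Γ X) ℓ

data Rewrite {Γ : Set a} {X : Set b} (R : TRS Γ X ℓ) :
             Rel (Term Γ X) (a ⊔ b ⊔ ℓ) where
  rewrite-at : ∀ (C : Context Γ X) (σ : X → Term Γ X) {l r} → R l r →
               Rewrite R (C [ subst σ l ]) (C [ subst σ r ])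

data Swap {Γ : Set a} {X : Set b} : TRS Γ X (a ⊔ b) where
  swap : ∀ f us x y ws → Unique (us ++ x ∷ y ∷ ws) →
         Swap (f ⟨ vars (us ++ x ∷ y ∷ ws) ⟩)
              (f ⟨ vars (us ++ y ∷ x ∷ ws) ⟩)

-- The quotient of terms by ≃, as a setoid: a tree is given by any term in
-- its class.
Tree : Set a → Set b → Setoid _ _
Tree Γ X = EqClosure.setoid (Rewrite (Swap {Γ = Γ} {X = X}))

infix 4 _≃_

_≃_ : {Γ : Set a} {X : Set b} → Rel (Term Γ X) (a ⊔ b)
_≃_ {Γ = Γ} {X = X} = Setoid._≈_ (Tree Γ X)

-- [s] → [t] holds when some representatives of the two classes rewrite.
TreeRewrite : {Γ : Set a} {X : Set b} → TRS Γ X ℓ →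
              Rel (Setoid.Carrier (Tree Γ X)) (a ⊔ b ⊔ ℓ)
TreeRewrite R s t = ∃₂ λ s′ t′ → s ≃ s′ × Rewrite R s′ t′ × t′ ≃ t

data Starred (Σ : Set a) : Set a where
  _★ : Σ → Starred Σ

infixl 6 _∪★

_∪★ : Set a → Set a
Σ ∪★ = Σ ⊎ Starred Σ

plain : Σ → Σ ∪★
plain = inj₁

star : Σ → Σ ∪★
star f = inj₂ (f ★)

data Star {Σ : Set a} {X : Set b} (_>_ : Rel Σ ℓ) :
          TRS (Σ ∪★) X (a ⊔ b ⊔ ℓ) where
  put    : ∀ f xs → Unique xs →
           Star _>_ (plain f ⟨ vars xs ⟩) (star f ⟨ vars xs ⟩)
  select : ∀ f xs y zs → Unique (xs ++ y ∷ zs) →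
           Star _>_ (star f ⟨ vars (xs ++ y ∷ zs) ⟩) (var y)
  copy   : ∀ f g xs (n : ℕ) → Unique xs → f > g →
           Star _>_ (star f ⟨ vars xs ⟩)
                    (plain g ⟨ replicate n (star f ⟨ vars xs ⟩) ⟩)
  down   : ∀ f g xs ys zs (n : ℕ) → Unique (xs ++ ys ++ zs) →
           Star _>_ (star f ⟨ vars xs ++ plain g ⟨ vars ys ⟩ ∷ vars zs ⟩)
                    (plain f ⟨ vars xs ++ replicate n (star g ⟨ vars ys ⟩)
                                       ++ vars zs ⟩)

-- The restriction of ⇝⁺ to star-free trees, which are the trees over Σ
-- included among those over Σ ∪★ by reading each f as plain f. Intermediate
-- trees may contain stars.
StarFree⇝⁺ : {Σ : Set a} {X : Set b} → Rel Σ ℓ →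
             Rel (Setoid.Carrier (Tree Σ X)) (a ⊔ b ⊔ ℓ)
StarFree⇝⁺ _>_ s t =
  TransClosure (TreeRewrite (Star _>_)) (relabel plain s) (relabel plain t)

{-# OPTIONS --safe #-}
module Submission where

-- Each star is given a finite label, a natural number that drops whenever
-- (copy) is applied to it, and each plain symbol the label ⊤⁺ above all the
-- numbers. Star-free terms carry only ⊤⁺, so along a given finite sequence
-- between star-free trees the labels of the stars can be chosen freely, and
-- the number of steps that remain is large enough: if s rewrites to t in one
-- step, then s with all stars labelled suc k rewrites in a labelled calculus
-- _▷_ to t with all stars labelled k (⇝⇒▷≽). A sequence between star-free
-- trees thus becomes one between labelled terms that depend only on the two
-- trees (StarFree⇒▷≽⁺).
--
-- The labelled calculus terminates (▷-wellFounded), because f ⟨ ts ⟩ with label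
-- l is accessible whenever all of ts are, by induction on f, then on the
-- multiset ts, then on l (node-acc). Steps inside an argument make the multiset
-- of arguments smaller, and so does (down), because a plain g steps by (put) to
-- a starred g with any finite label. (put) lowers the label only, and (select)
-- leads to an argument. (copy) puts a symbol smaller than f above copies of a
-- term with the symbol f and the arguments ts but a smaller label; these copies
-- are accessible, hence so is the whole.
--
-- Trees are unordered and labels must sometimes be lowered without any other
-- change. Both are absorbed by a preorder _≽_ on labelled terms, which permutes
-- arguments and lowers labels. It commutes with _▷_ (≽-simulates-▷), so that
-- _▷_ followed by _≽_ still terminates (▷≽-wellFounded).

open import Defs
open import Data.List.Base using (List; []; _∷_; _++_; map; replicate)
open import Data.List.Membership.Propositional using (_∈_)
open import Data.List.Membership.Propositional.Properties using (∈-map⁺; ∈-insert)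
open import Data.List.Properties using (map-++; map-replicate)
import Data.List.Relation.Binary.Permutation.Homogeneous as Perm
open Perm using (Permutation)
open import Data.List.Relation.Binary.Permutation.Propositional
  using (_↭_; ↭⇒↭ₛ; ↭-sym)
import Data.List.Relation.Binary.Permutation.Propositional as ↭
import Data.List.Relation.Binary.Permutation.Propositional.Properties as ↭
open import Data.List.Relation.Binary.Pointwise as Pointwise
  using (Pointwise; []; _∷_)
open import Data.List.Relation.Unary.All as All using (All; []; _∷_)
import Data.List.Relation.Unary.All.Properties as All
open import Data.List.Relation.Unary.Any using (here; there)
open import Data.Nat.Base using (ℕ; suc; _<_; _≤_)
open import Data.Nat.Induction using (<-wellFounded)
open import Data.Nat.Properties using (≤-refl; ≤-trans; <-≤-trans; n≤1+n; n<1+n)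
open import Data.Product.Base using (∃; _×_; _,_; -,_)
open import Data.Sum.Base using (inj₁; inj₂)
open import Function.Base using (flip; _∘_)
open import Induction.InfiniteDescent using (descent∧wf⇒empty)
open import Induction.WellFounded using (WellFounded; WfRec; Acc; acc)
import Induction.WellFounded as Wf
open import Level using (Level; _⊔_)
open import Relation.Binary.Bundles using (Setoid)
import Relation.Binary.Construct.Add.Supremum.NonStrict as NonStrict
import Relation.Binary.Construct.Add.Supremum.Strict as Strict
open import Relation.Binary.Construct.Closure.ReflexiveTransitive using (ε; _◅_)
open import Relation.Binary.Construct.Closure.Symmetric using (fwd; bwd)
open import Relation.Binary.Construct.Closure.Transitive as Plus
  using (TransClosure; _∷_; _∷ʳ_)
  renaming ([_] to [_]⁺)
import Relation.Binary.Construct.On as On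
open import Relation.Binary.Core using (Rel; _⇒_)
open import Relation.Binary.PropositionalEquality.Core
  using (_≡_; refl; cong; cong₂; subst₂)
open import Relation.Binary.Rewriting using (StronglyNormalizing)
open import Relation.Binary.Structures using (IsStrictPartialOrder)
open import Relation.Nullary.Construct.Add.Supremum using (_⁺; ⊤⁺)
  renaming ([_] to finite)
open import Relation.Nullary.Negation.Core using (¬_)

private
  variable
    a b r : Level
    A : Set a
    Γ Δ : Set a
    X Y : Set b

-- Multiset descent on lists

-- One step of the multiset extension of R, which reads R x y as "y is below x":
-- one element is replaced in place by finitely many elements below it.
data Replace {A : Set a} (R : Rel A r) : Rel (List A) (a ⊔ r) where
  here  : ∀ {x ys xs} → All (R x) ys → Replace R (x ∷ xs) (ys ++ xs)
  there : ∀ {x xs ys} → Replace R xs ys → Replace R (x ∷ xs) (x ∷ ys)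

Replace-++⁺ˡ : ∀ {R : Rel A r} us {xs ys} →
               Replace R xs ys → Replace R (us ++ xs) (us ++ ys)
Replace-++⁺ˡ []       p = p
Replace-++⁺ˡ (u ∷ us) p = there (Replace-++⁺ˡ us p)

module _ {R : Rel A r} where

  mutual
    Replace-acc-∷ : ∀ {x xs} → Acc (flip R) x → Acc (flip (Replace R)) xs →
                    Acc (flip (Replace R)) (x ∷ xs)
    Replace-acc-∷ x↓ xs↓ = acc (below-∷ x↓ xs↓)

    below-∷ : ∀ {x xs} → Acc (flip R) x → Acc (flip (Replace R)) xs →
              WfRec (flip (Replace R)) (Acc (flip (Replace R))) (x ∷ xs)
    below-∷ x↓ xs↓       (here rs) = Replace-acc-++ x↓ rs xs↓
    below-∷ x↓ (acc xs↓) (there p) = Replace-acc-∷ x↓ (xs↓ p)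

    Replace-acc-++ : ∀ {x xs ys} → Acc (flip R) x → All (R x) ys →
                     Acc (flip (Replace R)) xs →
                     Acc (flip (Replace R)) (ys ++ xs)
    Replace-acc-++ x↓         []       xs↓ = xs↓
    Replace-acc-++ x↓@(acc h) (r ∷ rs) xs↓ =
      Replace-acc-∷ (h r) (Replace-acc-++ x↓ rs xs↓)

  Replace-acc : ∀ {xs} → All (Acc (flip R)) xs → Acc (flip (Replace R)) xs
  Replace-acc []         = acc λ ()
  Replace-acc (x↓ ∷ xs↓) = Replace-acc-∷ x↓ (Replace-acc xs↓)

  Replace-preserves-All-acc : ∀ {xs ys} → Replace R xs ys →
                              All (Acc (flip R)) xs → All (Acc (flip R)) ys
  Replace-preserves-All-acc (here rs) (acc h ∷ xs↓) = All.++⁺ (All.map h rs) xs↓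
  Replace-preserves-All-acc (there p) (x↓ ∷ xs↓)    =
    x↓ ∷ Replace-preserves-All-acc p xs↓

-- Permutations up to a relation

module _ {R : Rel A r} where

  Permutation-++⁺ : ∀ {us vs xs ys} → Pointwise R us vs → Permutation R xs ys →
                    Permutation R (us ++ xs) (vs ++ ys)
  Permutation-++⁺ []       p = p
  Permutation-++⁺ (e ∷ es) p = Perm.prep e (Permutation-++⁺ es p)

  ↭⇒Permutation : (∀ {x} → R x x) → _↭_ ⇒ Permutation R
  ↭⇒Permutation R-refl p = Perm.map (λ { refl → R-refl }) (↭⇒↭ₛ p)

  ∈-Permutation : ∀ {xs ys y} → (∀ {x y z} → R x y → R y z → R x z) →
                  Permutation R xs ys → y ∈ ys → ∃ λ x → x ∈ xs × R x y
  ∈-Permutation R-trans = go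
    where
    go : ∀ {xs ys y} → Permutation R xs ys → y ∈ ys → ∃ λ x → x ∈ xs × R x y
    go (Perm.refl (e ∷ es)) (here refl) = -, here refl , e
    go (Perm.refl (e ∷ es)) (there i)   =
      let x , j , r = go (Perm.refl es) i in x , there j , r
    go (Perm.prep e p) (here refl) = -, here refl , e
    go (Perm.prep e p) (there i)   = let x , j , r = go p i in x , there j , r
    go (Perm.swap e₁ e₂ p) (here refl)         = -, there (here refl) , e₂
    go (Perm.swap e₁ e₂ p) (there (here refl)) = -, here refl , e₁
    go (Perm.swap e₁ e₂ p) (there (there i))   =
      let x , j , r = go p i in x , there (there j) , r
    go (Perm.trans p q) i =
      let y , j , r = go q i
          x , k , s = go p j
      in x , k , R-trans s r

-- Labels

open Strict _<_ using (_<⁺_; [_]<⊤⁺; <⁺-transˡ)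
  renaming ([_] to finite-<)
open NonStrict _≤_ using (_≤⁺_; _≤⊤⁺; ≤⁺-trans)
  renaming ([_] to finite-≤)

-- The finite labels are for the stars; ⊤⁺, above them all, marks a plain symbol.
Label : Set
Label = ℕ ⁺

≤⁺-refl : ∀ l → l ≤⁺ l
≤⁺-refl (finite k) = finite-≤ ≤-refl
≤⁺-refl ⊤⁺         = ⊤⁺ ≤⊤⁺

<⁺-wellFounded : WellFounded _<⁺_
<⁺-wellFounded = λ where
    (finite k) → finite-acc (<-wellFounded k)
    ⊤⁺         → acc λ where [ k ]<⊤⁺ → finite-acc (<-wellFounded k)
  where
  finite-acc : ∀ {k} → Acc _<_ k → Acc _<⁺_ (finite k)
  finite-acc (acc h) = acc λ where (finite-< p) → finite-acc (h p)

-- Terms, relabelling and substitution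

relabels≡map : ∀ (h : Γ → Δ) (ts : List (Term Γ X)) →
               relabels h ts ≡ map (relabel h) ts
relabels≡map h []       = refl
relabels≡map h (t ∷ ts) = cong (relabel h t ∷_) (relabels≡map h ts)

-- The instance of t under σ, relabelled by h.
inst : (Γ → Δ) → (X → Term Γ Y) → Term Γ X → Term Δ Y
inst h σ t = relabel h (subst σ t)

insts≡map : ∀ (h : Γ → Δ) (σ : X → Term Γ Y) ts →
            relabels h (substs σ ts) ≡ map (inst h σ) ts
insts≡map h σ []       = refl
insts≡map h σ (t ∷ ts) = cong (inst h σ t ∷_) (insts≡map h σ ts)

mutual
  relabel-∘ : ∀ {E : Set r} (h : Δ → E) (g : Γ → Δ) (t : Term Γ X) →
              relabel h (relabel g t) ≡ relabel (h ∘ g) t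
  relabel-∘ h g (var x)    = refl
  relabel-∘ h g (f ⟨ ts ⟩) = cong (h (g f) ⟨_⟩) (relabels-∘ h g ts)

  relabels-∘ : ∀ {E : Set r} (h : Δ → E) (g : Γ → Δ) (ts : List (Term Γ X)) →
               relabels h (relabels g ts) ≡ relabels (h ∘ g) ts
  relabels-∘ h g []       = refl
  relabels-∘ h g (t ∷ ts) = cong₂ _∷_ (relabel-∘ h g t) (relabels-∘ h g ts)

module _ {a b ℓ} {Σ : Set a} {X : Set b} (_>_ : Rel Σ ℓ) where

  -- The labelled calculus

  -- Terms over labelled symbols.
  LTerm : Set (a ⊔ b)
  LTerm = Term (Σ × Label) X

  infix 4 _⊒_ _≽_ _≽*_ _▷_ _▷≽_

  -- The same symbol with a possibly lower label.
  data _⊒_ : Rel (Σ × Label) a where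
    lower : ∀ {f l l′} → l′ ≤⁺ l → (f , l) ⊒ (f , l′)

  -- Lowering labels and permuting arguments, anywhere in a term.
  data _≽_ : Rel LTerm (a ⊔ b) where
    var  : ∀ {x} → var x ≽ var x
    node : ∀ {s s′ ts ts′} → s ⊒ s′ → Permutation _≽_ ts ts′ →
           s ⟨ ts ⟩ ≽ s′ ⟨ ts′ ⟩

  _≽*_ : Rel (List LTerm) (a ⊔ b)
  _≽*_ = Permutation _≽_

  -- The labelled steps. A step inside an argument and (down) both replace an
  -- argument by finitely many of its reducts; args covers both. As (down) turns
  -- a star into a plain symbol, args may change the label at will, even raise it.
  data _▷_ : Rel LTerm (a ⊔ b ⊔ ℓ) where
    put    : ∀ {f l l′ ts} → l′ <⁺ l → (f , l) ⟨ ts ⟩ ▷ (f , l′) ⟨ ts ⟩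
    select : ∀ {s t ts} → t ∈ ts → s ⟨ ts ⟩ ▷ t
    copy   : ∀ {f g l l′ ts} m n → f > g → l′ <⁺ l →
             (f , l) ⟨ ts ⟩ ▷ (g , m) ⟨ replicate n ((f , l′) ⟨ ts ⟩) ⟩
    args   : ∀ {f l l′ ts us} → Replace _▷_ ts us →
             (f , l) ⟨ ts ⟩ ▷ (f , l′) ⟨ us ⟩

  -- A labelled step, up to permuting arguments and lowering labels afterwards.
  _▷≽_ : Rel LTerm (a ⊔ b ⊔ ℓ)
  t ▷≽ v = ∃ λ u → t ▷ u × u ≽ v

  -- Termination of the labelled calculus

  module _ (>-wf : WellFounded (flip _>_)) where

    -- The induction on f, ts and l is lexicographic, in this order.
    mutual
      node-acc : ∀ {f l ts} → Acc (flip _>_) f → Acc (flip (Replace _▷_)) ts →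
                 Acc _<⁺_ l → All (Acc (flip _▷_)) ts →
                 Acc (flip _▷_) ((f , l) ⟨ ts ⟩)
      node-acc f↓ ts↓ l↓ all↓ = acc (below-node f↓ ts↓ l↓ all↓)

      below-node : ∀ {f l ts} → Acc (flip _>_) f →
                   Acc (flip (Replace _▷_)) ts → Acc _<⁺_ l →
                   All (Acc (flip _▷_)) ts →
                   WfRec (flip _▷_) (Acc (flip _▷_)) ((f , l) ⟨ ts ⟩)
      below-node f↓ ts↓ (acc l↓) all↓ (put l′<l) = node-acc f↓ ts↓ (l↓ l′<l) all↓
      below-node f↓ ts↓ l↓ all↓ (select t∈ts) = All.lookup all↓ t∈ts
      below-node f↓@(acc h) ts↓ (acc l↓) all↓ (copy m n f>g l′<l) =
        let copies↓ = All.replicate⁺ n (node-acc f↓ ts↓ (l↓ l′<l) all↓)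
        in node-acc (h f>g) (Replace-acc copies↓) (<⁺-wellFounded m) copies↓
      below-node f↓ (acc ts↓) l↓ all↓ (args p) =
        node-acc f↓ (ts↓ p) (<⁺-wellFounded _) (Replace-preserves-All-acc p all↓)

    mutual
      ▷-wellFounded : WellFounded (flip _▷_)
      ▷-wellFounded (var x)          = acc λ ()
      ▷-wellFounded ((f , l) ⟨ ts ⟩) =
        node-acc (>-wf f) (Replace-acc (all-acc ts)) (<⁺-wellFounded l) (all-acc ts)

      all-acc : ∀ ts → All (Acc (flip _▷_)) ts
      all-acc []       = []
      all-acc (t ∷ ts) = ▷-wellFounded t ∷ all-acc ts

  -- The preorder and its commutation with the labelled steps

  ⊒-refl : ∀ {s} → s ⊒ s
  ⊒-refl {f , l} = lower (≤⁺-refl l)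

  mutual
    ≽-refl : ∀ {t} → t ≽ t
    ≽-refl {var x}    = var
    ≽-refl {s ⟨ ts ⟩} = node ⊒-refl (Perm.refl (Pointwise-≽-refl ts))

    Pointwise-≽-refl : ∀ ts → Pointwise _≽_ ts ts
    Pointwise-≽-refl []       = []
    Pointwise-≽-refl (t ∷ ts) = ≽-refl ∷ Pointwise-≽-refl ts

  ≽*-refl : ∀ {ts} → ts ≽* ts
  ≽*-refl = Perm.refl (Pointwise-≽-refl _)

  ≽-trans : ∀ {t u v} → t ≽ u → u ≽ v → t ≽ v
  ≽-trans var                var                  = var
  ≽-trans (node (lower m) p) (node (lower m′) p′) =
    node (lower (≤⁺-trans ≤-trans m′ m)) (Perm.trans p p′)

  ↭⇒≽* : ∀ {ts us} → ts ↭ us → ts ≽* us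
  ↭⇒≽* = ↭⇒Permutation ≽-refl

  -- A term above t′ in _≽_ can do every step of t′: the larger label still
  -- bounds the new one strictly, and the arguments correspond up to _≽_.
  mutual
    ≽-simulates-▷ : ∀ {t t′ u′} → t ≽ t′ → t′ ▷ u′ → ∃ λ u → t ▷ u × u ≽ u′
    ≽-simulates-▷ (node (lower l′≤l) p) (put l″<l′) =
      -, put (<⁺-transˡ <-≤-trans l″<l′ l′≤l) , node ⊒-refl p
    ≽-simulates-▷ (node (lower l′≤l) p) (select t′∈) =
      let t , t∈ , t≽t′ = ∈-Permutation ≽-trans p t′∈ in t , select t∈ , t≽t′
    ≽-simulates-▷ (node (lower l′≤l) p) (copy m n f>g l″<l′) =
      -, copy m n f>g (<⁺-transˡ <-≤-trans l″<l′ l′≤l)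
       , node ⊒-refl (Perm.refl (Pointwise.replicate⁺ (node ⊒-refl p) n))
    ≽-simulates-▷ (node (lower l′≤l) p) (args q) =
      let us , q′ , p′ = ≽*-simulates-Replace p q
      in -, args q′ , node ⊒-refl p′

    ≽-simulates-All-▷ : ∀ {t t′ us′} → t ≽ t′ → All (t′ ▷_) us′ →
                        ∃ λ us → All (t ▷_) us × Pointwise _≽_ us us′
    ≽-simulates-All-▷ t≽t′ []       = [] , [] , []
    ≽-simulates-All-▷ t≽t′ (r ∷ rs) =
      let u  , q  , e  = ≽-simulates-▷ t≽t′ r
          us , qs , es = ≽-simulates-All-▷ t≽t′ rs
      in u ∷ us , q ∷ qs , e ∷ es

    ≽*-simulates-Replace : ∀ {ts ts′ us′} → ts ≽* ts′ → Replace _▷_ ts′ us′ →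
                           ∃ λ us → Replace _▷_ ts us × us ≽* us′
    ≽*-simulates-Replace (Perm.refl (e ∷ es)) (here rs) =
      let us , qs , es′ = ≽-simulates-All-▷ e rs
      in -, here qs , Permutation-++⁺ es′ (Perm.refl es)
    ≽*-simulates-Replace (Perm.refl (e ∷ es)) (there r) =
      let us , q , p = ≽*-simulates-Replace (Perm.refl es) r
      in -, there q , Perm.prep e p
    ≽*-simulates-Replace (Perm.prep e p) (here rs) =
      let us , qs , es = ≽-simulates-All-▷ e rs
      in -, here qs , Permutation-++⁺ es p
    ≽*-simulates-Replace (Perm.prep e p) (there r) =
      let us , q , p′ = ≽*-simulates-Replace p r
      in -, there q , Perm.prep e p′
    ≽*-simulates-Replace (Perm.swap e₁ e₂ p) (here rs) =
      let us , qs , es = ≽-simulates-All-▷ e₂ rs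
      in -, there (here qs)
          , Perm.trans (↭⇒≽* (↭-sym (↭.shift _ us _)))
                       (Permutation-++⁺ es (Perm.prep e₁ p))
    ≽*-simulates-Replace (Perm.swap e₁ e₂ p) (there (here rs)) =
      let us , qs , es = ≽-simulates-All-▷ e₁ rs
      in -, here qs
          , Perm.trans (↭⇒≽* (↭.shift _ us _))
                       (Perm.prep e₂ (Permutation-++⁺ es p))
    ≽*-simulates-Replace (Perm.swap e₁ e₂ p) (there (there r)) =
      let us , q , p′ = ≽*-simulates-Replace p r
      in -, there (there q) , Perm.swap e₁ e₂ p′
    ≽*-simulates-Replace (Perm.trans p₁ p₂) r =
      let _ , q₂ , p₂′ = ≽*-simulates-Replace p₂ r
          _ , q₁ , p₁′ = ≽*-simulates-Replace p₁ q₂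
      in -, q₁ , Perm.trans p₁′ p₂′

  ≽-▷≽ : ∀ {t u v} → t ≽ u → u ▷≽ v → t ▷≽ v
  ≽-▷≽ t≽u (w , u▷w , w≽v) =
    let w′ , t▷w′ , w′≽w = ≽-simulates-▷ t≽u u▷w
    in w′ , t▷w′ , ≽-trans w′≽w w≽v

  ▷≽-wellFounded : WellFounded (flip _>_) → WellFounded (flip _▷≽_)
  ▷≽-wellFounded >-wf t = ▷≽-acc (▷-wellFounded >-wf t) ≽-refl
    where
    -- Generalised to all t′ below t in _≽_, since each step ends in _≽_.
    ▷≽-acc : ∀ {t t′} → Acc (flip _▷_) t → t ≽ t′ → Acc (flip _▷≽_) t′
    ▷≽-acc (acc h) t≽t′ = acc λ t′▷≽v →
      let u , t▷u , u≽v = ≽-▷≽ t≽t′ t′▷≽v in ▷≽-acc (h t▷u) u≽v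

  -- Labelling the terms of Star

  -- All stars get the same label k.
  label : ℕ → Σ ∪★ → Σ × Label
  label k (inj₁ f)     = f , ⊤⁺
  label k (inj₂ (f ★)) = f , finite k

  label-suc-⊒ : ∀ k s → label (suc k) s ⊒ label k s
  label-suc-⊒ k (inj₁ f)     = ⊒-refl
  label-suc-⊒ k (inj₂ (f ★)) = lower (finite-≤ (n≤1+n k))

  module _ {h h′ : Σ ∪★ → Σ × Label} (h⊒h′ : ∀ s → h s ⊒ h′ s) where

    mutual
      relabel-mono : ∀ t → relabel h t ≽ relabel {X = X} h′ t
      relabel-mono (var x)    = var
      relabel-mono (s ⟨ ts ⟩) = node (h⊒h′ s) (Perm.refl (relabels-mono ts))

      relabels-mono : ∀ ts →
                      Pointwise _≽_ (relabels h ts) (relabels {X = X} h′ ts)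
      relabels-mono []       = []
      relabels-mono (t ∷ ts) = relabel-mono t ∷ relabels-mono ts

    map-relabel-mono : ∀ ts →
                       Pointwise _≽_ (map (relabel h) ts) (map (relabel h′) ts)
    map-relabel-mono ts = Pointwise.map⁺ _ _ (Pointwise.refl (relabel-mono _))

    ▷≽-in-context : ∀ (C : Context (Σ ∪★) X) {s t} →
                    relabel h s ▷≽ relabel h′ t →
                    relabel h (C [ s ]) ▷≽ relabel h′ (C [ t ])
    ▷≽-in-context □                    p = p
    ▷≽-in-context (_⟨_,_,_⟩ f us C vs) {s} {t} p
      rewrite relabels≡map h (us ++ C [ s ] ∷ vs)
            | relabels≡map h′ (us ++ C [ t ] ∷ vs)
            | map-++ (relabel h) us (C [ s ] ∷ vs)
            | map-++ (relabel h′) us (C [ t ] ∷ vs) =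
      let w , q , e = ▷≽-in-context C p
      in -, args (Replace-++⁺ˡ (map (relabel h) us) (here (q ∷ [])))
          , node (h⊒h′ f) (Perm.refl
              (Pointwise.++⁺ (map-relabel-mono us) (e ∷ map-relabel-mono vs)))

  ≽-in-context : ∀ h (C : Context (Σ ∪★) X) {s t} → relabel h s ≽ relabel h t →
                 relabel h (C [ s ]) ≽ relabel h (C [ t ])
  ≽-in-context h □                  p = p
  ≽-in-context h (_⟨_,_,_⟩ f us C vs) {s} {t} p
    rewrite relabels≡map h (us ++ C [ s ] ∷ vs)
          | relabels≡map h (us ++ C [ t ] ∷ vs)
          | map-++ (relabel h) us (C [ s ] ∷ vs)
          | map-++ (relabel h) us (C [ t ] ∷ vs) =
    node ⊒-refl (Perm.refl (Pointwise.++⁺ (Pointwise-≽-refl _)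
      (≽-in-context h C p ∷ Pointwise-≽-refl _)))

  insts-↭ : ∀ h (σ : X → Term (Σ ∪★) X) {ts us} → ts ↭ us →
            relabels h (substs σ ts) ≽* relabels h (substs σ us)
  insts-↭ h σ {ts} {us} p
    rewrite insts≡map h σ ts | insts≡map h σ us = ↭⇒≽* (↭.map⁺ _ p)

  ≃⇒≽ : ∀ h {s t : Term (Σ ∪★) X} → s ≃ t → relabel h s ≽ relabel h t
  ≃⇒≽ h ε = ≽-refl
  ≃⇒≽ h (fwd (rewrite-at C σ (swap f us x y ws _)) ◅ ps) =
    ≽-trans (≽-in-context h C (node ⊒-refl
              (insts-↭ h σ (↭.map⁺ var (↭.++⁺ˡ us (↭.swap x y ↭.refl))))))
            (≃⇒≽ h ps)
  ≃⇒≽ h (bwd (rewrite-at C σ (swap f us x y ws _)) ◅ ps) =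
    ≽-trans (≽-in-context h C (node ⊒-refl
              (insts-↭ h σ (↭.map⁺ var (↭.++⁺ˡ us (↭.swap y x ↭.refl))))))
            (≃⇒≽ h ps)

  module _ (k : ℕ) where

    private
      h  = label (suc k)
      h′ = label k

    insts-mono : ∀ (σ : X → Term (Σ ∪★) X) ts →
                 Pointwise _≽_ (map (inst h σ) ts) (map (inst h′ σ) ts)
    insts-mono σ ts =
      Pointwise.map⁺ _ _ (Pointwise.refl (relabel-mono (label-suc-⊒ k) _))

    -- The label drops from suc k to k on all stars, also those in the instances
    -- of the variables, where _≽_ lowers it; (copy) needs the strict drop on f.
    Star⇒▷≽ : ∀ σ {l r : Term (Σ ∪★) X} → Star _>_ l r →
              inst h σ l ▷≽ inst h′ σ r
    Star⇒▷≽ σ (put f xs _) =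
      -, put [ k ]<⊤⁺
       , node ⊒-refl (Perm.refl (relabels-mono (label-suc-⊒ k) _))
    Star⇒▷≽ σ (select f xs y zs _)
      rewrite insts≡map h σ (vars (xs ++ y ∷ zs)) =
      -, select (∈-map⁺ (inst h σ) (∈-map⁺ var (∈-insert xs)))
       , relabel-mono (label-suc-⊒ k) (σ y)
    Star⇒▷≽ σ (copy f g xs n _ f>g)
      rewrite insts≡map h′ σ (replicate n (star f ⟨ vars xs ⟩))
            | map-replicate (inst h′ σ) n (star f ⟨ vars xs ⟩) =
      -, copy ⊤⁺ n f>g (finite-< (n<1+n k))
       , node ⊒-refl (Perm.refl (Pointwise.replicate⁺
           (node ⊒-refl (Perm.refl (relabels-mono (label-suc-⊒ k) _))) n))
    Star⇒▷≽ σ (down f g xs ys zs n _)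
      rewrite insts≡map h σ (vars xs ++ plain g ⟨ vars ys ⟩ ∷ vars zs)
            | map-++ (inst h σ) (vars xs) (plain g ⟨ vars ys ⟩ ∷ vars zs)
            | insts≡map h′ σ (vars xs ++ replicate n (star g ⟨ vars ys ⟩) ++ vars zs)
            | map-++ (inst h′ σ) (vars xs) (replicate n (star g ⟨ vars ys ⟩) ++ vars zs)
            | map-++ (inst h′ σ) (replicate n (star g ⟨ vars ys ⟩)) (vars zs)
            | map-replicate (inst h′ σ) n (star g ⟨ vars ys ⟩) =
      -, args (Replace-++⁺ˡ (map (inst h σ) (vars xs))
           (here (All.replicate⁺ n (put [ k ]<⊤⁺))))
       , node ⊒-refl (Perm.refl
           (Pointwise.++⁺ (insts-mono σ (vars xs))
             (Pointwise.++⁺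
               (Pointwise.replicate⁺
                 (node ⊒-refl (Perm.refl (relabels-mono (label-suc-⊒ k) _))) n)
               (insts-mono σ (vars zs)))))

    ⇝⇒▷≽ : ∀ {s t} → TreeRewrite (Star _>_) s t → relabel h s ▷≽ relabel h′ t
    ⇝⇒▷≽ (_ , _ , s≃s′ , rewrite-at C σ s′⇝t′ , t′≃t) =
      let u , s′▷u , u≽t′ =
            ≽-▷≽ (≃⇒≽ h s≃s′)
                 (▷≽-in-context (label-suc-⊒ k) C (Star⇒▷≽ σ s′⇝t′))
      in u , s′▷u , ≽-trans u≽t′ (≃⇒≽ h′ t′≃t)

  -- The number of steps serves as the initial label of the stars.
  ⇝⁺⇒▷≽⁺ : ∀ {s t} → TransClosure (TreeRewrite (Star _>_)) s t →
           ∃ λ k → TransClosure _▷≽_ (relabel (label k) s) (relabel (label 0) t)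
  ⇝⁺⇒▷≽⁺ [ p ]⁺   = 1 , [ ⇝⇒▷≽ 0 p ]⁺
  ⇝⁺⇒▷≽⁺ (p ∷ ps) = let k , qs = ⇝⁺⇒▷≽⁺ ps in suc k , ⇝⇒▷≽ k p ∷ qs

  -- Star-free trees

  -- The labelled form of a star-free term, which is the same for every label of
  -- the stars.
  ⊤-labelled : Term Σ X → LTerm
  ⊤-labelled = relabel (_, ⊤⁺)

  StarFree⇒▷≽⁺ : ∀ {s t} → StarFree⇝⁺ _>_ s t →
                 TransClosure _▷≽_ (⊤-labelled s) (⊤-labelled t)
  StarFree⇒▷≽⁺ {s} {t} p =
    let k , q = ⇝⁺⇒▷≽⁺ p
    in subst₂ (TransClosure _▷≽_)
         (relabel-∘ (label k) plain s) (relabel-∘ (label 0) plain t) q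

  StarFree-wellFounded : WellFounded (flip _>_) →
                         WellFounded (flip (StarFree⇝⁺ {X = X} _>_))
  StarFree-wellFounded >-wf =
    Wf.Subrelation.wellFounded (reverse ∘ StarFree⇒▷≽⁺)
      (On.wellFounded ⊤-labelled
        (Plus.wellFounded (flip _▷≽_) (▷≽-wellFounded >-wf)))
    where
    reverse : ∀ {t u} → TransClosure _▷≽_ t u → TransClosure (flip _▷≽_) u t
    reverse [ p ]⁺   = [ p ]⁺
    reverse (p ∷ ps) = reverse ps ∷ʳ p

theorem3p7 : ∀ {a b ℓ} (Σ : Set a) (X : Set b) (_>_ : Rel Σ ℓ) →
    Infinite X →
    IsStrictPartialOrder _≡_ _>_ →
    WellFounded (flip _>_) →
    StronglyNormalizing (StarFree⇝⁺ {X = X} _>_) ×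
    ¬ (∃ λ (t : ℕ → Setoid.Carrier (Tree Σ X)) →
    ∀ i → StarFree⇝⁺ _>_ (t i) (t (suc i)))
theorem3p7 Σ X _>_ _ _ >-wf = sn , λ (t , t⇝t) →
  -- The terms of an infinite sequence would form a nonempty set without
  -- minimal element.
  descent∧wf⇒empty {P = λ s → ∃ λ i → s ≡ t i}
    (λ { (i , refl) → t (suc i) , t⇝t i , suc i , refl })
    sn (t 0) (0 , refl)
  where
  sn : StronglyNormalizing (StarFree⇝⁺ {X = X} _>_)
  sn = StarFree-wellFounded _>_ >-wf
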